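{- Let $m=m(n)$ and $k=k(n)$ be positive integer sequences with $n\ll m\ll n^2/\log^2 n$ and $k\ll\sqrt{m/n}$. For each $n$, let $\boldsymbol{\sigma}_{n,m}$ be a permutation chosen uniformly at random from the set of permutations of $[n]$ with exactly $m$ inversions. Then, for any sequence of permutations $(\tau_n)$ with $|\tau_n|=k$ and any sequence of positive integers $(j_n)$ with $j_n\leq n+1-k$, \[\mathbb{P}\big(\text{$\tau_n$ occurs at position $j_n$ in $\boldsymbol{\sigma}_{n,m}$}\big)\sim\frac{1}{k!}.\]
   Context: A permutation $\sigma$ of length $n$ is a linear ordering $\sigma(1)\ldots\sigma(n)$ of $[n]=\{1,\dots,n\}$; $|\sigma|$ denotes its length. An inversion of $\sigma$ is a pair $i<j$ with $\sigma(i)>\sigma(j)$. For sequences, $f(n)\ll g(n)$ means $f(n)/g(n)\to0$ as $n\to\infty$, and $f\sim g$ means $f(n)/g(n)\to1$. A pattern $\tau$ of length $k$ occurs at position $j$ in $\sigma$ if the sequence $\sigma(j)\sigma(j+1)\ldots\sigma(j+k-1)$ has its entries in the same relative order as $\tau(1)\ldots\tau(k)$. -}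

module Defs where

open import Data.Nat using (ℕ; zero; suc; _+_; _*_; _∸_; _^_; _≤_; _<_; _≟_; ∣_-_∣; _!)
open import Data.Nat.Logarithm using (⌊log₂_⌋)
import Data.Nat as ℕ
open import Data.Fin as Fin using (Fin; toℕ)
import Data.Fin.Properties as FinP
open import Data.Vec using (Vec; []; _∷_; lookup)
open import Data.List using (List; concatMap; map; filter; length; allFin) renaming ([] to []ˡ; _∷_ to _∷ˡ_)
open import Data.Product using (Σ; _×_; _,_; ∃-syntax)
open import Relation.Nullary using (Dec; yes; no; ¬_)
open import Relation.Nullary.Decidable using (_×-dec_; _→-dec_)
open import Relation.Binary.PropositionalEquality using (_≡_)

allVecs : (n k : ℕ) → List (Vec (Fin n) k)
allVecs n zero = [] ∷ˡ []ˡ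
allVecs n (suc k) = concatMap (λ x → map (x ∷_) (allVecs n k)) (allFin n)

IsPermutation : ∀ {n} → Vec (Fin n) n → Set
IsPermutation {n} σ = (i j : Fin n) → lookup σ i ≡ lookup σ j → i ≡ j

isPermutation? : ∀ {n} (σ : Vec (Fin n) n) → Dec (IsPermutation σ)
isPermutation? σ = FinP.all? λ i → FinP.all? λ j → (lookup σ i FinP.≟ lookup σ j) →-dec (i FinP.≟ j)

Perm : ℕ → Set
Perm n = Σ (Vec (Fin n) n) IsPermutation

InversionPair : ∀ {n} → Vec (Fin n) n → Fin n × Fin n → Set
InversionPair σ (i , j) = (i Fin.< j) × (lookup σ j Fin.< lookup σ i)

allPairs : (n : ℕ) → List (Fin n × Fin n)
allPairs n = concatMap (λ i → map (i ,_) (allFin n)) (allFin n)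

inversions : ∀ {n} → Vec (Fin n) n → ℕ
inversions {n} σ =
  length (filter (λ { (i , j) → (i FinP.<? j) ×-dec (lookup σ j FinP.<? lookup σ i) }) (allPairs n))

-- The permutations of [n] with exactly m inversions (each listed exactly once).
permsWithInversions : (n m : ℕ) → List (Vec (Fin n) n)
permsWithInversions n m =
  filter (λ σ → isPermutation? σ ×-dec (inversions σ ≟ m)) (allVecs n n)

-- Value (as a natural number) of the entry at 0-based index i (0 if out of range;
-- only used at in-range indices).
entry : ∀ {n k} → Vec (Fin n) k → ℕ → ℕ
entry [] i = 0
entry (x ∷ xs) zero = toℕ x
entry (x ∷ xs) (suc i) = entry xs i

-- τ (of length k) occurs at (1-based) position j in σ: σ(j)…σ(j+k-1) is in the
-- same relative order as τ(1)…τ(k).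
OccursAt : ∀ {k n} → Vec (Fin k) k → ℕ → Vec (Fin n) n → Set
OccursAt {k} τ j σ = (a b : Fin k) →
  (entry σ (j ∸ 1 + toℕ a) < entry σ (j ∸ 1 + toℕ b) → lookup τ a Fin.< lookup τ b) ×
  (lookup τ a Fin.< lookup τ b → entry σ (j ∸ 1 + toℕ a) < entry σ (j ∸ 1 + toℕ b))

occursAt? : ∀ {k n} (τ : Vec (Fin k) k) (j : ℕ) (σ : Vec (Fin n) n) → Dec (OccursAt τ j σ)
occursAt? τ j σ = FinP.all? λ a → FinP.all? λ b →
  ((entry σ (j ∸ 1 + toℕ a) ℕ.<? entry σ (j ∸ 1 + toℕ b)) →-dec (lookup τ a FinP.<? lookup τ b)) ×-dec
  ((lookup τ a FinP.<? lookup τ b) →-dec (entry σ (j ∸ 1 + toℕ a) ℕ.<? entry σ (j ∸ 1 + toℕ b)))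

countOccur : ∀ {k} (n m : ℕ) → Vec (Fin k) k → ℕ → ℕ
countOccur n m τ j = length (filter (occursAt? τ j) (permsWithInversions n m))

countTotal : (n m : ℕ) → ℕ
countTotal n m = length (permsWithInversions n m)

Eventually : (ℕ → Set) → Set
Eventually P = ∃[ N ] ((n : ℕ) → N ≤ n → P n)

{-# OPTIONS --safe #-}
-- Rearranging the entries of a window changes the number of inversions only through the
-- pattern in the window. Deleting the entries before and after the window one at a time
-- (the inversions lost by deleting an entry of a permutation of [i] range over 0, …, i-1)
-- shows that the permutations with pattern τ at a given position are enumerated by
-- q^inv(τ) N(q), N(q) = [k+1]_q ⋯ [n]_q, independently of the position, while all
-- permutations are enumerated by [k]_q! N(q). So k! times the first count is compared with
-- the second through the coefficients N_s for m - k² ≤ s ≤ m only, and it suffices that these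
-- are asymptotically equal. Indeed (s+1) N_{s+1} ≤ (s+n) N_s, and the palindromic symmetry of
-- N turns this into (D-s) N_s ≤ (D-s+n) N_{s+1} for D = deg N. Since k² n ≪ m and m ≪ D,
-- at most k² such steps change N_s by a factor 1 + o(1).
module Submission where

open import Defs
open import Data.Nat
open import Data.Nat.Properties
open import Data.Nat.ListAction using () renaming (sum to sumL)
open import Data.Nat.ListAction.Properties using (sum-++)
open import Data.Nat.Logarithm using (⌊log₂_⌋; ⌊log₂⌋-mono-≤)
open import Data.Nat.Tactic.RingSolver using (solve-∀)
open import Data.Fin as Fin using (Fin; zero; suc; toℕ; fromℕ; fromℕ<; opposite; punchIn; punchOut)
open import Data.Fin.Permutation using (reverse)
import Data.Fin.Properties as FinP
open import Data.List as List using (List; filter; length; concatMap)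
import Data.List.Properties as List
open import Data.List.Relation.Unary.All using (universal)
open import Data.Product using (_×_; _,_; proj₁; proj₂; ∃-syntax)
open import Data.Sum using (_⊎_; inj₁; inj₂)
open import Data.Vec using (Vec; []; _∷_; head; lookup; insertAt; map)
open import Data.Vec.Properties using (insertAt-lookup; insertAt-punchIn; lookup-map; tabulate∘lookup; tabulate-cong)
open import Algebra.Properties.CommutativeMonoid.Sum +-0-commutativeMonoid
open import Function using (_∘_; id)
open import Relation.Nullary using (¬_; Dec; yes; no; contradiction)
open import Relation.Nullary.Decidable using (_×-dec_)
open import Relation.Unary using (Decidable)
open import Relation.Binary.PropositionalEquality

*-swap : ∀ x y z → x * (y * z) ≡ y * (x * z)
*-swap = solve-∀

-- Coefficient sequences of power series

-- Multiplication by q^t.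
shift : ℕ → (ℕ → ℕ) → ℕ → ℕ
shift zero    F s       = F s
shift (suc t) F zero    = 0
shift (suc t) F (suc s) = shift t F s

-- Multiplication by [i]_q = 1 + q + ⋯ + q^(i-1).
box : ℕ → (ℕ → ℕ) → ℕ → ℕ
box zero    F s       = 0
box (suc i) F zero    = F zero
box (suc i) F (suc s) = F (suc s) + box i F s

-- Multiplication by [k+1]_q ⋯ [k+r]_q.
boxes : ℕ → ℕ → (ℕ → ℕ) → ℕ → ℕ
boxes k zero    F = F
boxes k (suc r) F = box (suc r + k) (boxes k r F)

-- The constant power series 1.
δ₀ : ℕ → ℕ
δ₀ zero    = 1
δ₀ (suc _) = 0

shift-∸ : ∀ t F s → t ≤ s → shift t F s ≡ F (s ∸ t)
shift-∸ zero    F s       _         = refl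
shift-∸ (suc t) F (suc s) (s≤s t≤s) = shift-∸ t F s t≤s

shift-suc : ∀ t F s → shift (suc t) F s ≡ shift 1 (shift t F) s
shift-suc t F zero    = refl
shift-suc t F (suc s) = refl

box-suc : ∀ i F s → box (suc i) F s ≡ F s + shift 1 (box i F) s
box-suc i F zero    = sym (+-identityʳ _)
box-suc i F (suc s) = refl

box-cong : ∀ i {F G} → F ≗ G → box i F ≗ box i G
box-cong zero    F≗G s       = refl
box-cong (suc i) F≗G zero    = F≗G zero
box-cong (suc i) F≗G (suc s) = cong₂ _+_ (F≗G (suc s)) (box-cong i F≗G s)

box-+ : ∀ i F G s → box i (λ x → F x + G x) s ≡ box i F s + box i G s
box-+ zero    F G s       = refl
box-+ (suc i) F G zero    = refl
box-+ (suc i) F G (suc s) rewrite box-+ i F G s =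
  interchange (F (suc s)) (G (suc s)) (box i F s) (box i G s)
  where
  interchange : ∀ a b c d → a + b + (c + d) ≡ a + c + (b + d)
  interchange = solve-∀

box-shift₁ : ∀ i F s → box i (shift 1 F) s ≡ shift 1 (box i F) s
box-shift₁ zero    F zero          = refl
box-shift₁ zero    F (suc s)       = refl
box-shift₁ (suc i) F zero          = refl
box-shift₁ (suc i) F (suc zero)    = trans (cong (F 0 +_) (box-shift₁ i F 0)) (+-identityʳ _)
box-shift₁ (suc i) F (suc (suc s)) = cong (F (suc s) +_) (box-shift₁ i F (suc s))

shift-cong : ∀ t {F G} → F ≗ G → shift t F ≗ shift t G
shift-cong zero    F≗G s       = F≗G s
shift-cong (suc t) F≗G zero    = refl
shift-cong (suc t) F≗G (suc s) = shift-cong t F≗G s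

box-shift : ∀ i t F s → box i (shift t F) s ≡ shift t (box i F) s
box-shift i zero    F s = refl
box-shift i (suc t) F s = begin
  box i (shift (suc t) F) s     ≡⟨ box-cong i (shift-suc t F) s ⟩
  box i (shift 1 (shift t F)) s ≡⟨ box-shift₁ i (shift t F) s ⟩
  shift 1 (box i (shift t F)) s ≡⟨ shift-cong 1 (box-shift i t F) s ⟩
  shift 1 (shift t (box i F)) s ≡⟨ shift-suc t (box i F) s ⟨
  shift (suc t) (box i F) s     ∎
  where open ≡-Reasoning

-- Induction on `j` through [j+1]_q = 1 + q [j]_q: multiplication by [i]_q is additive and commutes
-- with multiplication by q.
box-comm : ∀ i j F s → box i (box j F) s ≡ box j (box i F) s
box-comm i zero    F s = box-zero i s
  where
  box-zero : ∀ i s → box i (λ _ → 0) s ≡ 0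
  box-zero zero    s       = refl
  box-zero (suc i) zero    = refl
  box-zero (suc i) (suc s) = box-zero i s
box-comm i (suc j) F s = begin
  box i (box (suc j) F) s                     ≡⟨ box-cong i (box-suc j F) s ⟩
  box i (λ x → F x + shift 1 (box j F) x) s   ≡⟨ box-+ i F (shift 1 (box j F)) s ⟩
  box i F s + box i (shift 1 (box j F)) s     ≡⟨ cong (box i F s +_) (box-shift₁ i (box j F) s) ⟩
  box i F s + shift 1 (box i (box j F)) s     ≡⟨ cong (box i F s +_) (shift-cong 1 (box-comm i j F) s) ⟩
  box i F s + shift 1 (box j (box i F)) s     ≡⟨ box-suc j (box i F) s ⟨
  box (suc j) (box i F) s                     ∎
  where open ≡-Reasoning

boxes-cong : ∀ k r {F G} → F ≗ G → boxes k r F ≗ boxes k r G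
boxes-cong k zero    F≗G = F≗G
boxes-cong k (suc r) F≗G = box-cong (suc r + k) (boxes-cong k r F≗G)

boxes-shift : ∀ k r t F s → boxes k r (shift t F) s ≡ shift t (boxes k r F) s
boxes-shift k zero    t F s = refl
boxes-shift k (suc r) t F s =
  trans (box-cong (suc r + k) (boxes-shift k r t F) s) (box-shift (suc r + k) t (boxes k r F) s)

box-boxes : ∀ i k r F s → box i (boxes k r F) s ≡ boxes k r (box i F) s
box-boxes i k zero    F s = refl
box-boxes i k (suc r) F s =
  trans (box-comm i (suc r + k) (boxes k r F) s) (box-cong (suc r + k) (box-boxes i k r F) s)

boxes-comm : ∀ k r l t F s → boxes k r (boxes l t F) s ≡ boxes l t (boxes k r F) s
boxes-comm k zero    l t F s = refl
boxes-comm k (suc r) l t F s =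
  trans (box-cong (suc r + k) (boxes-comm k r l t F) s) (box-boxes (suc r + k) l t (boxes k r F) s)

boxes-split : ∀ k r F s → boxes 0 (r + k) F s ≡ boxes k r (boxes 0 k F) s
boxes-split k zero    F s = refl
boxes-split k (suc r) F s rewrite +-identityʳ (r + k) = box-cong (suc r + k) (boxes-split k r F) s

-- [i+1]_q = [i]_q + q^i splits off the top term, where `box-suc` splits off the bottom one. The
-- symmetry argument plays the two splittings against each other.
box-suc′ : ∀ i F s → box (suc i) F s ≡ box i F s + shift i F s
box-suc′ zero    F zero    = refl
box-suc′ zero    F (suc s) = +-identityʳ _
box-suc′ (suc i) F zero    = sym (+-identityʳ _)
box-suc′ (suc i) F (suc s) =
  trans (cong (F (suc s) +_) (box-suc′ i F s)) (sym (+-assoc (F (suc s)) _ _))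

-- For a product of f factors [i]_q, F s counts sequences e of length f and sum s. Weighting
-- the decrement of entry i by e_i gives total weight s + 1 to each e of sum s + 1, while a
-- sequence of sum s is reached with total weight at most s + f.
SlowGrowth : ℕ → (ℕ → ℕ) → Set
SlowGrowth f F = ∀ s → suc s * F (suc s) ≤ (s + f) * F s

box-≤-suc : ∀ i F s → box i F s ≤ box (suc i) F s
box-≤-suc zero    F s       = z≤n
box-≤-suc (suc i) F zero    = ≤-refl
box-≤-suc (suc i) F (suc s) = +-monoʳ-≤ (F (suc s)) (box-≤-suc i F s)

-- Since [i+1]_q F = F + q [i]_q F, the bounds for `F` and for `box i F` can be added. One copy of
-- `g₁` is left over, and `box-≤-suc` bounds it by `F (suc s) + g₀`, which is what raising `f` by
-- one provides.
box-slowGrowth : ∀ i {f F} → SlowGrowth f F → SlowGrowth (suc f) (box i F)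
box-slowGrowth zero    {f} {F} slow s = ≤-trans (≤-reflexive (*-zeroʳ s)) z≤n
box-slowGrowth (suc i) {f} {F} slow zero = begin
  1 * (F 1 + box i F 0)   ≡⟨ *-distribˡ-+ 1 (F 1) (box i F 0) ⟩
  1 * F 1 + 1 * box i F 0 ≤⟨ +-mono-≤ (slow 0) (≤-trans (≤-reflexive (*-identityˡ _)) (box-≤-suc i F 0)) ⟩
  f * F 0 + F 0           ≡⟨ +-comm (f * F 0) (F 0) ⟩
  suc f * F 0             ∎
  where open ≤-Reasoning
box-slowGrowth (suc i) {f} {F} slow (suc s) = begin
  (2 + s) * (F (2 + s) + g₁)
    ≡⟨ split s (F (2 + s)) g₁ ⟩
  (2 + s) * F (2 + s) + suc s * g₁ + g₁
    ≤⟨ +-mono-≤ (+-mono-≤ (slow (suc s)) (box-slowGrowth i slow s)) (box-≤-suc i F (suc s)) ⟩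
  (suc s + f) * F (suc s) + (s + suc f) * g₀ + (F (suc s) + g₀)
    ≡⟨ collect s f (F (suc s)) g₀ ⟩
  (suc s + suc f) * (F (suc s) + g₀) ∎
  where
  open ≤-Reasoning
  g₀ = box i F s
  g₁ = box i F (suc s)
  split : ∀ s a g → (2 + s) * (a + g) ≡ (2 + s) * a + suc s * g + g
  split = solve-∀
  collect : ∀ s f b g → (suc s + f) * b + (s + suc f) * g + (b + g) ≡ (suc s + suc f) * (b + g)
  collect = solve-∀

boxes-slowGrowth : ∀ k r → SlowGrowth r (boxes k r δ₀)
boxes-slowGrowth k zero    s = ≤-trans (≤-reflexive (*-zeroʳ s)) z≤n
boxes-slowGrowth k (suc r)   = box-slowGrowth (suc r + k) (boxes-slowGrowth k r)

-- Palindromic symmetry and degree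

record Palindromic (D : ℕ) (F : ℕ → ℕ) : Set where
  field
    mirror : ∀ s u → s + u ≡ D → F s ≡ F u
    vanish : ∀ s → D < s → F s ≡ 0
open Palindromic

-- A factor [i]_q raises the degree by i - 1. The bound s > D + i - 1 is written so as to avoid
-- truncated subtraction.
box-vanish : ∀ i {D F} → (∀ s → D < s → F s ≡ 0) → ∀ s → D + i < suc s → box i F s ≡ 0
box-vanish zero    zeros s _ = refl
box-vanish (suc i) {D} zeros zero    D+i<s =
  contradiction (≤-trans (s≤s (m≤n+m (suc i) D)) D+i<s) λ { (s≤s ()) }
box-vanish (suc i) {D} zeros (suc s) (s≤s D+i≤s) =
  cong₂ _+_ (zeros (suc s) (≤-trans (s≤s (m≤m+n D i)) D+1+i≤s)) (box-vanish i zeros s D+1+i≤s)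
  where
  D+1+i≤s : D + i < suc s
  D+1+i≤s = subst (_≤ suc s) (+-suc D i) D+i≤s

shift-vanish : ∀ t F s → s < t → shift t F s ≡ 0
shift-vanish (suc t) F zero    _         = refl
shift-vanish (suc t) F (suc s) (s≤s s<t) = shift-vanish t F s s<t

-- For `i ≤ u` this is the symmetry of `F` at `u ∸ i`; for `u < i` the index `s` exceeds `D` and
-- both sides vanish.
mirror-shift : ∀ i {D F} → Palindromic D F → ∀ s u → s + u ≡ D + i → F s ≡ shift i F u
mirror-shift i {D} {F} pal s u s+u≡D+i with i ≤? u
... | yes i≤u = trans (mirror pal s (u ∸ i) s+[u∸i]≡D) (sym (shift-∸ i F u i≤u))
  where
  s+[u∸i]≡D : s + (u ∸ i) ≡ D
  s+[u∸i]≡D = trans (sym (+-∸-assoc s i≤u)) (trans (cong (_∸ i) s+u≡D+i) (m+n∸n≡m D i))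
... | no i≰u = trans (vanish pal s D<s) (sym (shift-vanish i F u u<i))
  where
  u<i = ≰⇒> i≰u
  D<s : D < s
  D<s = +-cancelʳ-< u D s (subst (D + u <_) (sym s+u≡D+i) (+-monoʳ-< D u<i))

-- The product has degree D + i - 1. On the left the bottom term of [i]_q is split off, on the right
-- its top term, and the pieces correspond under the reflection.
box-mirror : ∀ i {D F} → Palindromic D F → ∀ s u → suc (s + u) ≡ D + i → box i F s ≡ box i F u
box-mirror zero    pal s u _ = refl
box-mirror (suc i) {D} {F} pal zero u 1+u≡ =
  trans (mirror-shift i pal zero u u≡)
    (sym (trans (box-suc′ i F u) (cong (_+ shift i F u) (box-high i u u≡))))
  where
  u≡ : u ≡ D + i
  u≡ = suc-injective (trans 1+u≡ (+-suc D i))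
  box-high : ∀ i u → u ≡ D + i → box i F u ≡ 0
  box-high i u refl = box-vanish i (vanish pal) u ≤-refl
box-mirror (suc i) {D} {F} pal (suc s) u eq = begin
  F (suc s) + box i F s   ≡⟨ cong₂ _+_ (mirror-shift i pal (suc s) u eq′) (box-mirror i pal s u eq′) ⟩
  shift i F u + box i F u ≡⟨ +-comm (shift i F u) _ ⟩
  box i F u + shift i F u ≡⟨ box-suc′ i F u ⟨
  box (suc i) F u         ∎
  where
  open ≡-Reasoning
  eq′ : suc s + u ≡ D + i
  eq′ = suc-injective (trans eq (+-suc D i))

box-palindromic : ∀ i {D F} → Palindromic D F → Palindromic (i + D) (box (suc i) F)
box-palindromic i {D} pal .mirror s u s+u≡ =
  box-mirror (suc i) pal s u (trans (cong suc (trans s+u≡ (+-comm i D))) (sym (+-suc D i)))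
box-palindromic i {D} pal .vanish s i+D<s =
  box-vanish (suc i) (vanish pal) s (s≤s (subst (_≤ s) (trans (cong suc (+-comm i D)) (sym (+-suc D i))) i+D<s))

-- The degree of [k+1]_q ⋯ [k+r]_q, since [r+k+1]_q has degree r + k.
degree : ℕ → ℕ → ℕ
degree k zero    = 0
degree k (suc r) = r + k + degree k r

boxes-palindromic : ∀ k r → Palindromic (degree k r) (boxes k r δ₀)
boxes-palindromic k zero .mirror zero    zero    _ = refl
boxes-palindromic k zero .vanish (suc s) _ = refl
boxes-palindromic k (suc r) = box-palindromic (r + k) (boxes-palindromic k r)

-- With n = r + k, twice the degree equals n(n-1) - k(k-1); the bound drops the final k.
degree-lower : ∀ k r → (r + k) * (r + k) ≤ 2 * degree k r + k * k + (r + k)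
degree-lower k zero    = m≤m+n (k * k) k
degree-lower k (suc r) = begin
  suc (r + k) * suc (r + k)                             ≡⟨ expand (r + k) ⟩
  (r + k) * (r + k) + 2 * (r + k) + 1                   ≤⟨ +-monoˡ-≤ 1 (+-monoˡ-≤ (2 * (r + k)) (degree-lower k r)) ⟩
  2 * degree k r + k * k + (r + k) + 2 * (r + k) + 1    ≡⟨ regroup (degree k r) (k * k) (r + k) ⟩
  2 * (r + k + degree k r) + k * k + suc (r + k)        ∎
  where
  open ≤-Reasoning
  expand : ∀ n → suc n * suc n ≡ n * n + 2 * n + 1
  expand = solve-∀
  regroup : ∀ d q n → 2 * d + q + n + 2 * n + 1 ≡ 2 * (n + d) + q + suc n
  regroup = solve-∀

-- Comparison of nearby coefficients

slow-decay : ∀ {f D F} → SlowGrowth f F → Palindromic D F →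
  ∀ s u → suc (s + u) ≡ D → suc u * F s ≤ (u + f) * F (suc s)
slow-decay {f} {D} {F} slow pal s u eq =
  -- The growth inequality at `u`, read through the reflection that exchanges `suc u` with `s` and
  -- `u` with `suc s`.
  subst₂ (λ x y → suc u * x ≤ (u + f) * y)
    (mirror pal (suc u) s (trans (cong suc (+-comm u s)) eq))
    (mirror pal u (suc s) (trans (trans (+-suc u s) (cong suc (+-comm u s))) eq))
    (slow u)

-- Bernoulli's inequality (1 - n/p)^i ≥ 1 - in/p, where p = M + n and q = p - in.
iterate-bound : ∀ {M n} (a : ℕ → ℕ) l → (∀ i → i < l → M * a (suc i) ≤ (M + n) * a i) →
  ∀ i q → i ≤ l → q + i * n ≡ M + n → 1 ≤ M → q * a i ≤ (M + n) * a 0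
iterate-bound {M} {n} a l step zero q _ q≡ _ =
  ≤-reflexive (cong (_* a 0) (trans (sym (+-identityʳ q)) q≡))
iterate-bound {M} {n} a l step (suc i) q i<l q≡ 1≤M =
  *-cancelˡ-≤ (M + n) {{>-nonZero (≤-trans 1≤M (m≤m+n M n))}} (begin
    (M + n) * (q * a (suc i))       ≡⟨ *-assoc (M + n) q _ ⟨
    (M + n) * q * a (suc i)         ≤⟨ *-monoˡ-≤ (a (suc i)) cross ⟩
    (q + n) * M * a (suc i)         ≡⟨ *-assoc (q + n) M _ ⟩
    (q + n) * (M * a (suc i))       ≤⟨ *-monoʳ-≤ (q + n) (step i i<l) ⟩
    (q + n) * ((M + n) * a i)       ≡⟨ *-swap (q + n) (M + n) (a i) ⟩
    (M + n) * ((q + n) * a i)       ≤⟨ *-monoʳ-≤ (M + n) (iterate-bound a l step i (q + n) (<⇒≤ i<l) (trans (+-assoc q n _) q≡) 1≤M) ⟩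
    (M + n) * ((M + n) * a 0)       ∎)
  where
  open ≤-Reasoning
  q≤M : q ≤ M
  q≤M = +-cancelʳ-≤ n q M (≤-trans (+-monoʳ-≤ q (m≤m+n n (i * n))) (≤-reflexive q≡))
  -- As x/(x+n) increases with x, `q ≤ M` gives q/(q+n) ≤ M/(M+n).
  cross : (M + n) * q ≤ (q + n) * M
  cross = begin
    (M + n) * q   ≡⟨ *-distribʳ-+ q M n ⟩
    M * q + n * q ≤⟨ +-mono-≤ (≤-reflexive (*-comm M q)) (*-monoʳ-≤ n q≤M) ⟩
    q * M + n * M ≡⟨ *-distribʳ-+ M q n ⟨
    (q + n) * M   ∎

-- (s+f)/(s+1) ≤ 1 + f/(s+1) ≤ 1 + n/M: a bound on the ratio of neighbours that no longer depends on
-- `s`, so that it can be iterated.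
weaken-ratio : ∀ {M n s f x y} → M ≤ suc s → f ≤ n →
  suc s * x ≤ (s + f) * y → M * x ≤ (M + n) * y
weaken-ratio {M} {n} {s} {f} {x} {y} M≤1+s f≤n le = *-cancelˡ-≤ (suc s) (begin
  suc s * (M * x)         ≡⟨ *-swap (suc s) M x ⟩
  M * (suc s * x)         ≤⟨ *-monoʳ-≤ M le ⟩
  M * ((s + f) * y)       ≡⟨ *-assoc M (s + f) y ⟨
  M * (s + f) * y         ≤⟨ *-monoˡ-≤ y cross ⟩
  suc s * (M + n) * y     ≡⟨ *-assoc (suc s) (M + n) y ⟩
  suc s * ((M + n) * y)   ∎)
  where
  open ≤-Reasoning
  cross : M * (s + f) ≤ suc s * (M + n)
  cross = begin
    M * (s + f)           ≡⟨ *-distribˡ-+ M s f ⟩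
    M * s + M * f         ≤⟨ +-mono-≤ (*-monoʳ-≤ M (n≤1+n s)) (*-mono-≤ M≤1+s f≤n) ⟩
    M * suc s + suc s * n ≡⟨ cong (_+ suc s * n) (*-comm M (suc s)) ⟩
    suc s * M + suc s * n ≡⟨ *-distribˡ-+ (suc s) M n ⟨
    suc s * (M + n)       ∎

-- The l steps cost a factor of at most p/(p - ln) with p = M + n, and (e+1)ln ≤ M ≤ p makes this at
-- most (e+1)/e.
iterate-close : ∀ {M n e} (a : ℕ → ℕ) l → 1 ≤ M → suc e * (l * n) ≤ M →
  (∀ i → i < l → M * a (suc i) ≤ (M + n) * a i) → e * a l ≤ suc e * a 0
iterate-close {M} {n} {e} a l 1≤M big step = *-cancelˡ-≤ (M + n) {{p>0}} (begin
  (M + n) * (e * a l)       ≡⟨ *-assoc (M + n) e (a l) ⟨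
  (M + n) * e * a l         ≤⟨ *-monoˡ-≤ (a l) ep≤ ⟩
  suc e * q * a l           ≡⟨ *-assoc (suc e) q (a l) ⟩
  suc e * (q * a l)         ≤⟨ *-monoʳ-≤ (suc e) (iterate-bound a l step l q ≤-refl q≡ 1≤M) ⟩
  suc e * ((M + n) * a 0)   ≡⟨ *-swap (suc e) (M + n) (a 0) ⟩
  (M + n) * (suc e * a 0)   ∎)
  where
  open ≤-Reasoning
  p>0 = >-nonZero (≤-trans 1≤M (m≤m+n M n))
  q = M + n ∸ l * n
  big′ : suc e * (l * n) ≤ M + n
  big′ = ≤-trans big (m≤m+n M n)
  q≡ : q + l * n ≡ M + n
  q≡ = m∸n+n≡m (≤-trans (m≤m+n (l * n) (e * (l * n))) big′)
  ep≤ : (M + n) * e ≤ suc e * q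
  ep≤ = +-cancelʳ-≤ (suc e * (l * n)) _ _ (begin
    (M + n) * e + suc e * (l * n) ≤⟨ +-monoʳ-≤ ((M + n) * e) big′ ⟩
    (M + n) * e + (M + n)         ≡⟨ collect (M + n) e ⟩
    suc e * (M + n)               ≡⟨ cong (suc e *_) q≡ ⟨
    suc e * (q + l * n)           ≡⟨ *-distribˡ-+ (suc e) q (l * n) ⟩
    suc e * q + suc e * (l * n)   ∎)
    where
    collect : ∀ p e → p * e + p ≡ suc e * p
    collect = solve-∀

-- All indices of the window from m - K to m stay at distance at least (e+1)Kn from 0 by `low` and
-- from `D` by `high`. Hence a step in either direction costs a factor of at most (M+n)/M, and at
-- most `K` steps cost at most (e+1)/e.
module _ {f n D m K e F} (slow : SlowGrowth f F) (pal : Palindromic D F) (f≤n : f ≤ n)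
  (1≤M : 1 ≤ suc e * (K * n)) (low : suc e * (K * n) + K ≤ m) (high : suc e * (K * n) + m ≤ D) where

  private
    M = suc e * (K * n)

    dist : ∀ {s s′} → m ≤ s + K → s′ ≤ m → s′ ∸ s ≤ K
    dist {s} {s′} m≤s+K s′≤m = m≤n+o⇒m∸n≤o s′ s (≤-trans s′≤m m≤s+K)

    budget : ∀ {l} → l ≤ K → suc e * (l * n) ≤ M
    budget l≤K = *-monoʳ-≤ (suc e) (*-monoˡ-≤ n l≤K)

    M≤ : ∀ {s} → m ≤ s + K → M ≤ s
    M≤ {s} m≤s+K = +-cancelʳ-≤ K M s (≤-trans low m≤s+K)

  close-up : ∀ {s s′} → m ≤ s + K → s ≤ s′ → s′ ≤ m → e * F s′ ≤ suc e * F s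
  close-up {s} {s′} m≤s+K s≤s′ s′≤m =
    subst₂ (λ x y → e * F x ≤ suc e * F y) (m∸n+n≡m s≤s′) refl
      (iterate-close {e = e} (λ i → F (i + s)) (s′ ∸ s) 1≤M (budget (dist m≤s+K s′≤m))
        λ i _ → weaken-ratio (≤-trans (M≤ m≤s+K) (≤-trans (m≤n+m s i) (n≤1+n _))) f≤n (slow (i + s)))

  -- The sequence is read downwards from `s′`, and `slow-decay` takes the place of the growth
  -- inequality.
  close-down : ∀ {s s′} → m ≤ s + K → s ≤ s′ → s′ ≤ m → e * F s ≤ suc e * F s′
  close-down {s} {s′} m≤s+K s≤s′ s′≤m =
    subst₂ (λ x y → e * F x ≤ suc e * F y) (m∸[m∸n]≡n s≤s′) refl
      (iterate-close {e = e} (λ i → F (s′ ∸ i)) (s′ ∸ s) 1≤M (budget (dist m≤s+K s′≤m)) step)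
    where
    step : ∀ i → i < s′ ∸ s → M * F (s′ ∸ suc i) ≤ (M + n) * F (s′ ∸ i)
    step i i<l = subst (λ x → M * F (s′ ∸ suc i) ≤ (M + n) * F x) 1+t≡
      (weaken-ratio M≤1+u f≤n (slow-decay slow pal (s′ ∸ suc i) (D ∸ (s′ ∸ i)) t+u≡))
      where
      i<s′ : i < s′
      i<s′ = ≤-trans i<l (m∸n≤m s′ s)
      1+t≡ : suc (s′ ∸ suc i) ≡ s′ ∸ i
      1+t≡ = sym (+-∸-assoc 1 i<s′)
      t+M≤D : s′ ∸ i + M ≤ D
      t+M≤D = ≤-trans (+-monoˡ-≤ M (≤-trans (m∸n≤m s′ i) s′≤m)) (≤-trans (≤-reflexive (+-comm m M)) high)
      t+u≡ : suc (s′ ∸ suc i + (D ∸ (s′ ∸ i))) ≡ D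
      t+u≡ = trans (cong (_+ (D ∸ (s′ ∸ i))) 1+t≡) (m+[n∸m]≡n (≤-trans (m≤m+n (s′ ∸ i) M) t+M≤D))
      M≤1+u : M ≤ suc (D ∸ (s′ ∸ i))
      M≤1+u = m≤n⇒m≤1+n (m+n≤o⇒m≤o∸n M (≤-trans (≤-reflexive (+-comm M (s′ ∸ i))) t+M≤D))

  close : ∀ {s s′} → m ≤ s + K → s ≤ m → m ≤ s′ + K → s′ ≤ m → e * F s ≤ suc e * F s′
  close {s} {s′} lo hi lo′ hi′ with ≤-total s s′
  ... | inj₁ s≤s′ = close-down lo s≤s′ hi′
  ... | inj₂ s′≤s = close-up lo′ s′≤s hi

-- Multiplication by [k]_q! as a weighted sum over a window

box-upper : ∀ i {α β F} m → (∀ s → s ≤ m → m < s + i → α * F s ≤ β) → α * box i F m ≤ i * β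
box-upper zero    {α} m _ = ≤-reflexive (*-zeroʳ α)
box-upper (suc i) {α} {β} zero bound = ≤-trans (bound 0 z≤n (s≤s z≤n)) (m≤m+n β (i * β))
box-upper (suc i) {α} {β} {F} (suc m) bound = begin
  α * (F (suc m) + box i F m)       ≡⟨ *-distribˡ-+ α (F (suc m)) (box i F m) ⟩
  α * F (suc m) + α * box i F m     ≤⟨ +-mono-≤ (bound (suc m) ≤-refl (m<m+n (suc m) (s≤s z≤n)))
                                        (box-upper i {α} {F = F} m λ s s≤m m<s+i →
                                          bound s (m≤n⇒m≤1+n s≤m) (≤-trans (s≤s m<s+i) (≤-reflexive (sym (+-suc s i))))) ⟩
  β + i * β                         ∎
  where open ≤-Reasoning

-- The condition `i ≤ suc m` ensures that the sum really has `i` terms, none being cut off at index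
-- 0.
box-lower : ∀ i {α β F} m → i ≤ suc m → (∀ s → s ≤ m → m < s + i → α ≤ β * F s) → i * α ≤ β * box i F m
box-lower zero    m _ _ = z≤n
box-lower (suc zero) {α} zero _ bound = ≤-trans (≤-reflexive (*-identityˡ α)) (bound 0 z≤n (s≤s z≤n))
box-lower (suc (suc i)) zero (s≤s ()) _
box-lower (suc i) {α} {β} {F} (suc m) (s≤s i≤1+m) bound = begin
  α + i * α                         ≤⟨ +-mono-≤ (bound (suc m) ≤-refl (m<m+n (suc m) (s≤s z≤n)))
                                        (box-lower i {β = β} {F = F} m i≤1+m λ s s≤m m<s+i →
                                          bound s (m≤n⇒m≤1+n s≤m) (≤-trans (s≤s m<s+i) (≤-reflexive (sym (+-suc s i))))) ⟩
  β * F (suc m) + β * box i F m     ≡⟨ *-distribˡ-+ β (F (suc m)) (box i F m) ⟨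
  β * (F (suc m) + box i F m)       ∎
  where open ≤-Reasoning

square-step : ∀ {k m s x} → m < s + suc k → s ≤ x + k * k → m ≤ x + suc k * suc k
square-step {k} {m} {s} {x} m<s+1+k s≤x+k² = begin
  m                         ≤⟨ <⇒≤ m<s+1+k ⟩
  s + suc k                 ≤⟨ +-monoˡ-≤ (suc k) s≤x+k² ⟩
  x + k * k + suc k         ≤⟨ m≤m+n _ k ⟩
  x + k * k + suc k + k     ≡⟨ collect x k ⟩
  x + suc k * suc k         ∎
  where
  open ≤-Reasoning
  collect : ∀ x k → x + k * k + suc k + k ≡ x + suc k * suc k
  collect = solve-∀

-- `boxes 0 k` is multiplication by [k]_q!, whose coefficients sum to k! and whose degree is at most
-- k². So coefficient `m` of the product combines coefficients of `F` from the window m - k², ..., m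
-- with total weight at most k!.
boxes-upper : ∀ k {α β F} m → (∀ s → s ≤ m → m ≤ s + k * k → α * F s ≤ β) → α * boxes 0 k F m ≤ k ! * β
boxes-upper zero {β = β} m bound = ≤-trans (bound m ≤-refl (m≤m+n m 0)) (m≤m+n β 0)
boxes-upper (suc k) {α} {β} {F} m bound rewrite +-identityʳ k = begin
  α * box (suc k) (boxes 0 k F) m ≤⟨ box-upper (suc k) {α} {F = boxes 0 k F} m (λ s s≤m m<s+1+k → boxes-upper k {α} {F = F} s
                                      λ x x≤s s≤x+k² → bound x (≤-trans x≤s s≤m) (square-step m<s+1+k s≤x+k²)) ⟩
  suc k * (k ! * β)               ≡⟨ *-assoc (suc k) (k !) β ⟨
  suc k ! * β                     ∎
  where open ≤-Reasoning

-- Under `k * k ≤ m` no term of [k]_q! reaches below index 0, so the full weight k! is present.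
boxes-lower : ∀ k {α β F} m → k * k ≤ m → (∀ s → s ≤ m → m ≤ s + k * k → α ≤ β * F s) → k ! * α ≤ β * boxes 0 k F m
boxes-lower zero {α} m _ bound = ≤-trans (≤-reflexive (+-identityʳ α)) (bound m ≤-refl (m≤m+n m 0))
boxes-lower (suc k) {α} {β} {F} m k²≤m bound rewrite +-identityʳ k = begin
  suc k ! * α                     ≡⟨ *-assoc (suc k) (k !) α ⟩
  suc k * (k ! * α)               ≤⟨ box-lower (suc k) {β = β} {F = boxes 0 k F} m (m≤n⇒m≤1+n (≤-trans (m≤m+n (suc k) _) k²≤m))
                                      (λ s s≤m m<s+1+k → boxes-lower k {β = β} {F = F} s (room s m<s+1+k)
                                        λ x x≤s s≤x+k² → bound x (≤-trans x≤s s≤m) (square-step m<s+1+k s≤x+k²)) ⟩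
  β * box (suc k) (boxes 0 k F) m ∎
  where
  open ≤-Reasoning
  room : ∀ s → m < s + suc k → k * k ≤ s
  room s m<s+1+k = +-cancelʳ-≤ (suc k) (k * k) s (begin
    k * k + suc k       ≤⟨ m≤m+n _ k ⟩
    k * k + suc k + k   ≡⟨ collect k ⟩
    suc k * suc k       ≤⟨ k²≤m ⟩
    m                   ≤⟨ <⇒≤ m<s+1+k ⟩
    s + suc k           ∎)
    where
    collect : ∀ k → k * k + suc k + k ≡ suc k * suc k
    collect = solve-∀

-- Subtracting `e` times the smaller number leaves e|x - y| at most the smaller of the two, hence at
-- most `y`.
dist-bound : ∀ {e x y} → e * x ≤ suc e * y → e * y ≤ suc e * x → e * ∣ x - y ∣ ≤ y
dist-bound {e} {x} {y} ex≤ ey≤ with ≤-total x y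
... | inj₁ x≤y rewrite m≤n⇒∣m-n∣≡n∸m x≤y | *-distribˡ-∸ e y x =
  ≤-trans (m≤n+o⇒m∸n≤o (e * y) (e * x) (≤-trans ey≤ (≤-reflexive (+-comm x (e * x))))) x≤y
... | inj₂ y≤x rewrite m≤n⇒∣n-m∣≡n∸m y≤x | *-distribˡ-∸ e x y =
  m≤n+o⇒m∸n≤o (e * x) (e * y) (≤-trans ex≤ (≤-reflexive (+-comm y (e * y))))

-- Sums over vectors and indicators

private variable
  A B : Set
  n k : ℕ

ind : {P : Set} → Dec P → ℕ
ind (yes _) = 1
ind (no _)  = 0

ind-yes : {P : Set} (P? : Dec P) → P → ind P? ≡ 1
ind-yes (yes _) _ = refl
ind-yes (no ¬p) p = contradiction p ¬p

ind-no : {P : Set} (P? : Dec P) → ¬ P → ind P? ≡ 0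
ind-no (yes p) ¬p = contradiction p ¬p
ind-no (no _)  _  = refl

ind-cong : {P Q : Set} (P? : Dec P) (Q? : Dec Q) → (P → Q) → (Q → P) → ind P? ≡ ind Q?
ind-cong (yes p) Q? f g = sym (ind-yes Q? (f p))
ind-cong (no ¬p) Q? f g = sym (ind-no Q? (¬p ∘ g))

sum-zero : (f : Fin n → ℕ) → (∀ i → f i ≡ 0) → sum f ≡ 0
sum-zero {n} f f≗0 = trans (sum-cong-≗ f≗0) (sum-replicate-zero n)

sumV : ∀ n k → (Vec (Fin n) k → ℕ) → ℕ
sumV n zero    f = f []
sumV n (suc k) f = sum λ x → sumV n k (f ∘ (x ∷_))

sumV-cong : ∀ n k {f g : Vec (Fin n) k → ℕ} → f ≗ g → sumV n k f ≡ sumV n k g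
sumV-cong n zero    f≗g = f≗g []
sumV-cong n (suc k) f≗g = sum-cong-≗ λ x → sumV-cong n k (f≗g ∘ (x ∷_))

sumV-zero : ∀ n k (f : Vec (Fin n) k → ℕ) → (∀ v → f v ≡ 0) → sumV n k f ≡ 0
sumV-zero n zero    f f≗0 = f≗0 []
sumV-zero n (suc k) f f≗0 = sum-zero _ λ x → sumV-zero n k _ (f≗0 ∘ (x ∷_))

-- Exchanging neighbouring sums moves coordinate `i` to the outside, so that the entry to be deleted
-- can be summed over last.
sumV-insertAt : ∀ n k (i : Fin (suc k)) (f : Vec (Fin n) (suc k) → ℕ) →
  sumV n (suc k) f ≡ sum λ x → sumV n k λ v → f (insertAt v i x)
sumV-insertAt n k       zero    f = refl
sumV-insertAt n (suc k) (suc i) f = begin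
  (sum λ y → sumV n (suc k) (f ∘ (y ∷_)))
    ≡⟨ sum-cong-≗ (λ y → sumV-insertAt n k i (f ∘ (y ∷_))) ⟩
  (sum λ y → sum λ x → sumV n k λ v → f (y ∷ insertAt v i x))
    ≡⟨ ∑-comm (λ y x → sumV n k λ v → f (y ∷ insertAt v i x)) ⟩
  (sum λ x → sum λ y → sumV n k λ v → f (y ∷ insertAt v i x)) ∎
  where open ≡-Reasoning

-- Only vectors that avoid `x` contribute, and these are the images under `punchIn x` of the vectors
-- over one value fewer.
sumV-punchIn : ∀ n k (x : Fin (suc n)) (f : Vec (Fin (suc n)) k → ℕ) →
  (∀ v a → lookup v a ≡ x → f v ≡ 0) → sumV (suc n) k f ≡ sumV n k (f ∘ map (punchIn x))
sumV-punchIn n zero    x f avoid = refl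
sumV-punchIn n (suc k) x f avoid = begin
  (sum λ y → sumV (suc n) k (f ∘ (y ∷_)))
    ≡⟨ sum-remove {i = x} (λ y → sumV (suc n) k (f ∘ (y ∷_))) ⟩
  sumV (suc n) k (f ∘ (x ∷_)) + (sum λ y → sumV (suc n) k (f ∘ (punchIn x y ∷_)))
    ≡⟨ cong₂ _+_ (sumV-zero (suc n) k _ λ v → avoid (x ∷ v) zero refl)
         (sum-cong-≗ λ y → sumV-punchIn n k x _ λ v a → avoid (punchIn x y ∷ v) (suc a)) ⟩
  (sum λ y → sumV n k λ v → f (punchIn x y ∷ map (punchIn x) v)) ∎
  where open ≡-Reasoning

sumV-single : ∀ n k (τ : Vec (Fin n) k) (f : Vec (Fin n) k → ℕ) →
  (∀ v → v ≢ τ → f v ≡ 0) → sumV n k f ≡ f τ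
sumV-single n       zero    []      f off = refl
sumV-single (suc n) (suc k) (x ∷ τ) f off = begin
  (sum λ y → sumV (suc n) k (f ∘ (y ∷_)))
    ≡⟨ sum-remove {i = x} (λ y → sumV (suc n) k (f ∘ (y ∷_))) ⟩
  sumV (suc n) k (f ∘ (x ∷_)) + (sum λ y → sumV (suc n) k (f ∘ (punchIn x y ∷_)))
    ≡⟨ cong₂ _+_ (sumV-single (suc n) k τ _ λ v v≢τ → off (x ∷ v) λ { refl → v≢τ refl })
         (sum-zero _ λ y → sumV-zero (suc n) k _ λ v → off _ λ eq → FinP.punchInᵢ≢i x y (cong head eq)) ⟩
  f (x ∷ τ) + 0
    ≡⟨ +-identityʳ _ ⟩
  f (x ∷ τ) ∎
  where open ≡-Reasoning

-- From filtered lists to sums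

length-filter-sum : {P : A → Set} (P? : Decidable P) (xs : List A) →
  length (filter P? xs) ≡ sumL (List.map (λ x → ind (P? x)) xs)
length-filter-sum P? List.[] = refl
length-filter-sum P? (x List.∷ xs) with P? x
... | yes _ = cong suc (length-filter-sum P? xs)
... | no _  = length-filter-sum P? xs

length-filter-filter : {P Q : A → Set} (P? : Decidable P) (Q? : Decidable Q) (xs : List A) →
  length (filter Q? (filter P? xs)) ≡ length (filter (λ x → P? x ×-dec Q? x) xs)
length-filter-filter P? Q? List.[] = refl
length-filter-filter P? Q? (x List.∷ xs) with P? x
... | no _  = length-filter-filter P? Q? xs
... | yes _ with Q? x
...   | yes _ = cong suc (length-filter-filter P? Q? xs)
...   | no _  = length-filter-filter P? Q? xs

sum-concatMap-tabulate : (f : B → ℕ) (g : A → List B) (h : Fin n → A) →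
  sumL (List.map f (concatMap g (List.tabulate h))) ≡ sum λ i → sumL (List.map f (g (h i)))
sum-concatMap-tabulate {n = zero}  f g h = refl
sum-concatMap-tabulate {n = suc n} f g h = begin
  sumL (List.map f (g (h zero) List.++ rest))
    ≡⟨ cong sumL (List.map-++ f (g (h zero)) rest) ⟩
  sumL (List.map f (g (h zero)) List.++ List.map f rest)
    ≡⟨ sum-++ (List.map f (g (h zero))) (List.map f rest) ⟩
  sumL (List.map f (g (h zero))) + sumL (List.map f rest)
    ≡⟨ cong (sumL (List.map f (g (h zero))) +_) (sum-concatMap-tabulate f g (h ∘ suc)) ⟩
  (sum λ i → sumL (List.map f (g (h i)))) ∎
  where
  open ≡-Reasoning
  rest = concatMap g (List.tabulate (h ∘ suc))

sum-map-tabulate : (f : A → ℕ) (h : Fin n → A) → sumL (List.map f (List.tabulate h)) ≡ sum (f ∘ h)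
sum-map-tabulate {n = zero}  f h = refl
sum-map-tabulate {n = suc n} f h = cong (f (h zero) +_) (sum-map-tabulate f (h ∘ suc))

sum-allVecs : ∀ n k (f : Vec (Fin n) k → ℕ) → sumL (List.map f (allVecs n k)) ≡ sumV n k f
sum-allVecs n zero    f = +-identityʳ (f [])
sum-allVecs n (suc k) f = trans
  (sum-concatMap-tabulate f (λ x → List.map (x ∷_) (allVecs n k)) id)
  (sum-cong-≗ λ x → trans (cong sumL (sym (List.map-∘ (allVecs n k)))) (sum-allVecs n k (f ∘ (x ∷_))))

-- Inversion numbers and counts of smaller or larger values

inversion? : (σ : Vec (Fin n) n) (i j : Fin n) → Dec (InversionPair σ (i , j))
inversion? σ i j = (i FinP.<? j) ×-dec (lookup σ j FinP.<? lookup σ i)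

inversions-sum : (σ : Vec (Fin n) n) → inversions σ ≡ ∑[ i < n ] ∑[ j < n ] ind (inversion? σ i j)
inversions-sum {n} σ = trans (length-filter-sum _ (allPairs n)) (trans
  (sum-concatMap-tabulate {n = n} _ (λ i → List.map (i ,_) (List.allFin n)) id)
  (sum-cong-≗ {n} λ i → trans (cong sumL (sym (List.map-∘ (List.allFin n)))) (sum-map-tabulate {n = n} _ id)))

sum-≤ : ∀ c (f : Fin n → ℕ) → (∀ i → f i ≤ c) → sum f ≤ n * c
sum-≤ {zero}  c f f≤c = z≤n
sum-≤ {suc n} c f f≤c = +-mono-≤ (f≤c zero) (sum-≤ c (f ∘ suc) (f≤c ∘ suc))

-- This crude bound is enough for a pattern of length k, because the window of coefficients already
-- has width k².
inversions-≤ : (σ : Vec (Fin n) n) → inversions σ ≤ n * n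
inversions-≤ {n} σ = subst (_≤ n * n) (sym (inversions-sum σ))
  (sum-≤ n _ λ i → ≤-trans (sum-≤ 1 _ λ j → ind-≤ (inversion? σ i j)) (≤-reflexive (*-identityʳ n)))
  where
  ind-≤ : {P : Set} (P? : Dec P) → ind P? ≤ 1
  ind-≤ (yes _) = ≤-refl
  ind-≤ (no _)  = z≤n

count-below : ∀ n (x : Fin n) → ∑[ y < n ] ind (y FinP.<? x) ≡ toℕ x
count-below (suc n) zero    = sum-zero {suc n} _ λ y → ind-no (y FinP.<? zero {n}) λ ()
count-below (suc n) (suc x) = cong₂ _+_ (ind-yes (zero {n} FinP.<? suc x) (s≤s z≤n))
  (trans (sum-cong-≗ {n} λ y → ind-cong (suc y FinP.<? suc x) (y FinP.<? x) s≤s⁻¹ s≤s) (count-below n x))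

count-above : ∀ n (x : Fin n) → ∑[ y < n ] ind (x FinP.<? y) ≡ toℕ (opposite x)
count-above (suc n) zero = trans (cong₂ _+_ (ind-no (zero {n} FinP.<? zero {n}) λ ())
  (trans (sum-cong-≗ {n} λ y → ind-yes (zero {n} FinP.<? suc y) (s≤s z≤n)) (sum-one n))) (sym (FinP.toℕ-fromℕ n))
  where
  sum-one : ∀ n → ∑[ i < n ] 1 ≡ n
  sum-one zero    = refl
  sum-one (suc n) = cong suc (sum-one n)
count-above (suc n) (suc x) = trans (cong₂ _+_ (ind-no (suc x FinP.<? zero {n}) λ ())
  (trans (sum-cong-≗ {n} λ y → ind-cong (suc x FinP.<? suc y) (x FinP.<? y) s≤s⁻¹ s≤s) (count-above n x)))
  (sym (FinP.toℕ-inject₁ (opposite x)))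

sum-remove-zero : ∀ (i : Fin (suc n)) f → f i ≡ 0 → sum f ≡ ∑[ j < n ] f (punchIn i j)
sum-remove-zero {n} i f fi≡0 =
  trans (sum-remove {i = i} f) (cong (_+ ∑[ j < n ] f (punchIn i j)) fi≡0)

count-below-punchIn : ∀ n (x : Fin (suc n)) → ∑[ y < n ] ind (punchIn x y FinP.<? x) ≡ toℕ x
count-below-punchIn n x = trans
  (sym (sum-remove-zero x (λ y → ind (y FinP.<? x)) (ind-no (x FinP.<? x) (FinP.<-irrefl refl))))
  (count-below (suc n) x)

count-above-punchIn : ∀ n (x : Fin (suc n)) → ∑[ y < n ] ind (x FinP.<? punchIn x y) ≡ toℕ (opposite x)
count-above-punchIn n x = trans
  (sym (sum-remove-zero x (λ y → ind (x FinP.<? y)) (ind-no (x FinP.<? x) (FinP.<-irrefl refl))))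
  (count-above (suc n) x)

-- An injective self-map of a finite set is a bijection, so it only reorders the sum. The induction
-- removes the value `h zero` and closes the gap with `punchOut`.
sum-injective : (h : Fin n → Fin n) → (∀ i j → h i ≡ h j → i ≡ j) → ∀ g → sum (g ∘ h) ≡ sum g
sum-injective {zero}  h inj g = refl
sum-injective {suc n} h inj g = begin
  g x + sum (λ a → g (h (suc a)))     ≡⟨ cong (g x +_) (sum-cong-≗ λ a → cong g (sym (FinP.punchIn-punchOut (x≢ a)))) ⟩
  g x + sum (λ a → g (punchIn x (h′ a))) ≡⟨ cong (g x +_) (sum-injective h′ inj′ (g ∘ punchIn x)) ⟩
  g x + sum (g ∘ punchIn x)           ≡⟨ sum-remove {i = x} g ⟨
  sum g                               ∎
  where
  open ≡-Reasoning
  x = h zero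
  x≢ : ∀ a → x ≢ h (suc a)
  x≢ a eq = contradiction (inj zero (suc a) eq) λ ()
  h′ : Fin n → Fin n
  h′ a = punchOut (x≢ a)
  inj′ : ∀ i j → h′ i ≡ h′ j → i ≡ j
  inj′ i j eq = FinP.suc-injective (inj (suc i) (suc j) (FinP.punchOut-injective (x≢ i) (x≢ j) eq))

sum-permutation : (σ : Vec (Fin n) n) → IsPermutation σ → ∀ g → (sum λ a → g (lookup σ a)) ≡ sum g
sum-permutation σ perm = sum-injective (lookup σ) perm

-- Inserting one entry into a permutation

punchIn-mono-< : ∀ (x : Fin (suc n)) a b → a Fin.< b → punchIn x a Fin.< punchIn x b
punchIn-mono-< x a b a<b = ≰⇒> λ b≤a → <⇒≱ a<b (FinP.punchIn-cancel-≤ x b a b≤a)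

punchIn-cancel-< : ∀ (x : Fin (suc n)) a b → punchIn x a Fin.< punchIn x b → a Fin.< b
punchIn-cancel-< x a b a<b = ≰⇒> λ b≤a → <⇒≱ a<b (FinP.punchIn-mono-≤ x b a b≤a)

punchIn-view : (i a : Fin (suc n)) → a ≡ i ⊎ ∃[ a′ ] a ≡ punchIn i a′
punchIn-view i a with i FinP.≟ a
... | yes i≡a = inj₁ (sym i≡a)
... | no i≢a  = inj₂ (punchOut i≢a , sym (FinP.punchIn-punchOut i≢a))

-- The inverse of deleting entry `i` and standardising: old values from `x` upwards are raised by
-- one to make room for the new value.
insertEntry : Fin (suc n) → Fin (suc n) → Vec (Fin n) n → Vec (Fin (suc n)) (suc n)
insertEntry i x v = insertAt (map (punchIn x) v) i x

module _ (i x : Fin (suc n)) (v : Vec (Fin n) n) where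

  lookup-new : lookup (insertEntry i x v) i ≡ x
  lookup-new = insertAt-lookup (map (punchIn x) v) i x

  lookup-old : ∀ a → lookup (insertEntry i x v) (punchIn i a) ≡ punchIn x (lookup v a)
  lookup-old a = trans (insertAt-punchIn (map (punchIn x) v) i x a) (lookup-map a (punchIn x) v)

  insertEntry-permutation⁻ : IsPermutation (insertEntry i x v) → IsPermutation v
  insertEntry-permutation⁻ perm a b eq = FinP.punchIn-injective i a b
    (perm _ _ (trans (lookup-old a) (trans (cong (punchIn x) eq) (sym (lookup-old b)))))

  insertEntry-permutation⁺ : IsPermutation v → IsPermutation (insertEntry i x v)
  insertEntry-permutation⁺ perm a b eq with punchIn-view i a | punchIn-view i b
  ... | inj₁ refl        | inj₁ refl        = refl
  ... | inj₁ refl        | inj₂ (b′ , refl) =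
    contradiction (trans (sym (lookup-old b′)) (trans (sym eq) lookup-new)) (FinP.punchInᵢ≢i x _)
  ... | inj₂ (a′ , refl) | inj₁ refl        =
    contradiction (trans (sym (lookup-old a′)) (trans eq lookup-new)) (FinP.punchInᵢ≢i x _)
  ... | inj₂ (a′ , refl) | inj₂ (b′ , refl) =
    cong (punchIn i) (perm a′ b′ (FinP.punchIn-injective x _ _
      (trans (sym (lookup-old a′)) (trans eq (lookup-old b′)))))

  -- Inversions are split according to whether the new entry is the left member, the right member or
  -- absent. Among the old entries all comparisons are preserved.
  inversions-insertEntry : inversions (insertEntry i x v) ≡
    ∑[ b < n ] ind ((i FinP.<? punchIn i b) ×-dec (punchIn x (lookup v b) FinP.<? x)) +
    (∑[ a < n ] ind ((punchIn i a FinP.<? i) ×-dec (x FinP.<? punchIn x (lookup v a))) + inversions v)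
  inversions-insertEntry = begin
    inversions w
      ≡⟨ inversions-sum w ⟩
    ∑[ a < suc n ] ∑[ b < suc n ] I a b
      ≡⟨ sum-remove {i = i} (λ a → ∑[ b < suc n ] I a b) ⟩
    ∑[ b < suc n ] I i b + ∑[ a < n ] ∑[ b < suc n ] I (punchIn i a) b
      ≡⟨ cong₂ _+_ (sum-remove-zero i (I i) (ind-no (inversion? w i i) (FinP.<-irrefl refl ∘ proj₁)))
           (sum-cong-≗ {n} λ a → sum-remove {i = i} (I (punchIn i a))) ⟩
    ∑[ b < n ] I i (punchIn i b) +
      ∑[ a < n ] (I (punchIn i a) i + ∑[ b < n ] I (punchIn i a) (punchIn i b))
      ≡⟨ cong₂ _+_ (sum-cong-≗ {n} row) (trans
           (∑-distrib-+ {n} (λ a → I (punchIn i a) i) (λ a → ∑[ b < n ] I (punchIn i a) (punchIn i b)))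
           (cong₂ _+_ (sum-cong-≗ {n} column)
             (trans (sum-cong-≗ {n} λ a → sum-cong-≗ {n} λ b → rest a b) (sym (inversions-sum v))))) ⟩
    _ ∎
    where
    open ≡-Reasoning
    w = insertEntry i x v
    I : Fin (suc n) → Fin (suc n) → ℕ
    I a b = ind (inversion? w a b)
    row : ∀ b → I i (punchIn i b) ≡ ind ((i FinP.<? punchIn i b) ×-dec (punchIn x (lookup v b) FinP.<? x))
    row b = ind-cong _ _
      (λ (p , q) → p , subst₂ Fin._<_ (lookup-old b) lookup-new q)
      (λ (p , q) → p , subst₂ Fin._<_ (sym (lookup-old b)) (sym lookup-new) q)
    column : ∀ a → I (punchIn i a) i ≡ ind ((punchIn i a FinP.<? i) ×-dec (x FinP.<? punchIn x (lookup v a)))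
    column a = ind-cong _ _
      (λ (p , q) → p , subst₂ Fin._<_ lookup-new (lookup-old a) q)
      (λ (p , q) → p , subst₂ Fin._<_ (sym lookup-new) (sym (lookup-old a)) q)
    rest : ∀ a b → I (punchIn i a) (punchIn i b) ≡ ind (inversion? v a b)
    rest a b = ind-cong _ _
      (λ (p , q) → punchIn-cancel-< i a b p ,
        punchIn-cancel-< x _ _ (subst₂ Fin._<_ (lookup-old b) (lookup-old a) q))
      (λ (p , q) → punchIn-mono-< i a b p ,
        subst₂ Fin._<_ (sym (lookup-old b)) (sym (lookup-old a)) (punchIn-mono-< x _ _ q))

-- An entry in front forms an inversion with exactly the smaller values, and there are `toℕ x` of
-- them.
inversions-insert-first : ∀ (x : Fin (suc n)) v → IsPermutation v →
  inversions (insertEntry zero x v) ≡ toℕ x + inversions v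
inversions-insert-first {n} x v perm = trans (inversions-insertEntry zero x v) (cong₂ _+_
  (trans (sum-cong-≗ {n} λ b →
      ind-cong ((zero {n} FinP.<? suc b) ×-dec below b) (below b) proj₂ (s≤s z≤n ,_))
    (trans (sum-permutation v perm (λ y → ind (punchIn x y FinP.<? x))) (count-below-punchIn n x)))
  (cong (_+ inversions v) (sum-zero {n} _ λ a →
    ind-no ((suc a FinP.<? zero {n}) ×-dec (x FinP.<? punchIn x (lookup v a))) λ ())))
  where
  below : ∀ b → Dec (punchIn x (lookup v b) Fin.< x)
  below b = punchIn x (lookup v b) FinP.<? x

-- An entry at the end forms an inversion with exactly the larger values, hence the reversed count.
inversions-insert-last : ∀ (x : Fin (suc n)) v → IsPermutation v →
  inversions (insertEntry (fromℕ n) x v) ≡ toℕ (opposite x) + inversions v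
inversions-insert-last {n} x v perm = trans (inversions-insertEntry (fromℕ n) x v) (cong₂ _+_
  (sum-zero {n} _ λ b →
    ind-no ((fromℕ n FinP.<? punchIn (fromℕ n) b) ×-dec (punchIn x (lookup v b) FinP.<? x))
      λ (p , _) → <⇒≱ p (FinP.≤fromℕ (punchIn (fromℕ n) b)))
  (cong (_+ inversions v)
    (trans (sum-cong-≗ {n} λ a →
        ind-cong ((punchIn (fromℕ n) a FinP.<? fromℕ n) ×-dec above a) (above a) proj₂
          (FinP.≤∧≢⇒< (FinP.≤fromℕ _) (FinP.punchInᵢ≢i (fromℕ n) a) ,_))
      (trans (sum-permutation v perm (λ y → ind (x FinP.<? punchIn x y))) (count-above-punchIn n x)))))
  where
  above : ∀ a → Dec (x Fin.< punchIn x (lookup v a))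
  above a = x FinP.<? punchIn x (lookup v a)

-- Pattern occurrences under insertion

entry-lookup : (v : Vec (Fin n) k) (a : Fin k) → entry v (toℕ a) ≡ toℕ (lookup v a)
entry-lookup (x ∷ v) zero    = refl
entry-lookup (x ∷ v) (suc a) = entry-lookup v a

entry-lookup′ : (v : Vec (Fin n) k) {l : ℕ} (l<k : l < k) → entry v l ≡ toℕ (lookup v (fromℕ< l<k))
entry-lookup′ v l<k = trans (cong (entry v) (sym (FinP.toℕ-fromℕ< l<k))) (entry-lookup v (fromℕ< l<k))

entry-insert-last : (v : Vec (Fin n) k) (x : Fin n) (l : ℕ) → l < k →
  entry (insertAt v (fromℕ k) x) l ≡ entry v l
entry-insert-last (y ∷ v) x zero    _         = refl
entry-insert-last (y ∷ v) x (suc l) (s≤s l<k) = entry-insert-last v x l l<k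

entry-map-punchIn : (x : Fin (suc n)) (v : Vec (Fin n) k) {l : ℕ} (l<k : l < k) →
  entry (map (punchIn x) v) l ≡ toℕ (punchIn x (lookup v (fromℕ< l<k)))
entry-map-punchIn x v l<k =
  trans (entry-lookup′ (map (punchIn x) v) l<k) (cong toℕ (lookup-map (fromℕ< l<k) (punchIn x) v))

entry-punchIn-mono : (x : Fin (suc n)) (v : Vec (Fin n) k) {l l′ : ℕ} → l < k → l′ < k →
  entry v l < entry v l′ → entry (map (punchIn x) v) l < entry (map (punchIn x) v) l′
entry-punchIn-mono x v l<k l′<k =
  subst₂ _<_ (sym (entry-map-punchIn x v l<k)) (sym (entry-map-punchIn x v l′<k)) ∘
  punchIn-mono-< x _ _ ∘ subst₂ _<_ (entry-lookup′ v l<k) (entry-lookup′ v l′<k)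

entry-punchIn-cancel : (x : Fin (suc n)) (v : Vec (Fin n) k) {l l′ : ℕ} → l < k → l′ < k →
  entry (map (punchIn x) v) l < entry (map (punchIn x) v) l′ → entry v l < entry v l′
entry-punchIn-cancel x v l<k l′<k =
  subst₂ _<_ (sym (entry-lookup′ v l<k)) (sym (entry-lookup′ v l′<k)) ∘
  punchIn-cancel-< x _ _ ∘ subst₂ _<_ (entry-map-punchIn x v l<k) (entry-map-punchIn x v l′<k)

Iff : (P Q : Set) → Set
Iff P Q = (P → Q) × (Q → P)

-- An occurrence depends only on the comparisons inside the window. Positions are 1-based, so
-- `suc p` makes the window start at index `p`.
occursAt-cong : ∀ {n n′} (τ : Vec (Fin k) k) p p′ (σ : Vec (Fin n) n) (σ′ : Vec (Fin n′) n′) →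
  (∀ (a b : Fin k) → Iff (entry σ (p + toℕ a) < entry σ (p + toℕ b))
                          (entry σ′ (p′ + toℕ a) < entry σ′ (p′ + toℕ b))) →
  Iff (OccursAt τ (suc p) σ) (OccursAt τ (suc p′) σ′)
occursAt-cong τ p p′ σ σ′ same =
  (λ occ a b → proj₁ (occ a b) ∘ proj₂ (same a b) , proj₁ (same a b) ∘ proj₂ (occ a b)) ,
  (λ occ a b → proj₁ (occ a b) ∘ proj₁ (same a b) , proj₂ (same a b) ∘ proj₂ (occ a b))

occursAt-insert-first : ∀ (τ : Vec (Fin k) k) p x (v : Vec (Fin n) n) → p + k ≤ n →
  Iff (OccursAt τ (suc (suc p)) (insertEntry zero x v)) (OccursAt τ (suc p) v)
occursAt-insert-first τ p x v p+k≤n = occursAt-cong τ (suc p) p (insertEntry zero x v) v λ a b →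
  entry-punchIn-cancel x v (inside a) (inside b) , entry-punchIn-mono x v (inside a) (inside b)
  where
  inside : ∀ a → p + toℕ a < _
  inside a = ≤-trans (+-monoʳ-< p (FinP.toℕ<n a)) p+k≤n

occursAt-insert-last : ∀ (τ : Vec (Fin k) k) p x (v : Vec (Fin n) n) → p + k ≤ n →
  Iff (OccursAt τ (suc p) (insertEntry (fromℕ n) x v)) (OccursAt τ (suc p) v)
occursAt-insert-last {n = n} τ p x v p+k≤n = occursAt-cong τ p p (insertEntry (fromℕ n) x v) v λ a b →
  entry-punchIn-cancel x v (inside a) (inside b) ∘ subst₂ _<_ (old a) (old b) ,
  subst₂ _<_ (sym (old a)) (sym (old b)) ∘ entry-punchIn-mono x v (inside a) (inside b)
  where
  inside : ∀ a → p + toℕ a < n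
  inside a = ≤-trans (+-monoʳ-< p (FinP.toℕ<n a)) p+k≤n
  old : ∀ a → entry (insertEntry (fromℕ n) x v) (p + toℕ a) ≡ entry (map (punchIn x) v) (p + toℕ a)
  old a = entry-insert-last (map (punchIn x) v) x (p + toℕ a) (inside a)

-- Each entry of a permutation equals the number of entries smaller than it, so the relative order
-- determines all values.
permutation-by-order : (σ τ : Vec (Fin n) n) → IsPermutation σ → IsPermutation τ →
  (∀ a b → Iff (lookup σ a Fin.< lookup σ b) (lookup τ a Fin.< lookup τ b)) → σ ≡ τ
permutation-by-order {n} σ τ permσ permτ same =
  trans (sym (tabulate∘lookup σ)) (trans (tabulate-cong entries) (tabulate∘lookup τ))
  where
  open ≡-Reasoning
  entries : ∀ a → lookup σ a ≡ lookup τ a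
  entries a = FinP.toℕ-injective (begin
    toℕ (lookup σ a)
      ≡⟨ count-below n (lookup σ a) ⟨
    ∑[ y < n ] ind (y FinP.<? lookup σ a)
      ≡⟨ sum-permutation σ permσ (λ y → ind (y FinP.<? lookup σ a)) ⟨
    ∑[ b < n ] ind (lookup σ b FinP.<? lookup σ a)
      ≡⟨ sum-cong-≗ {n} (λ b → ind-cong (lookup σ b FinP.<? lookup σ a) (lookup τ b FinP.<? lookup τ a)
           (proj₁ (same b a)) (proj₂ (same b a))) ⟩
    ∑[ b < n ] ind (lookup τ b FinP.<? lookup τ a)
      ≡⟨ sum-permutation τ permτ (λ y → ind (y FinP.<? lookup τ a)) ⟩
    ∑[ y < n ] ind (y FinP.<? lookup τ a)
      ≡⟨ count-below n (lookup τ a) ⟩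
    toℕ (lookup τ a) ∎)

-- Counting occurrences

Counted : Vec (Fin k) k → ℕ → ℕ → Vec (Fin n) n → Set
Counted τ j s σ = (IsPermutation σ × inversions σ ≡ s) × OccursAt τ j σ

counted? : (τ : Vec (Fin k) k) (j s : ℕ) (σ : Vec (Fin n) n) → Dec (Counted τ j s σ)
counted? τ j s σ = (isPermutation? σ ×-dec (inversions σ ≟ s)) ×-dec occursAt? τ j σ

countOccur-sumV : ∀ n s (τ : Vec (Fin k) k) j →
  countOccur n s τ j ≡ sumV n n λ σ → ind (counted? τ j s σ)
countOccur-sumV n s τ j =
  trans (length-filter-filter (λ σ → isPermutation? σ ×-dec (inversions σ ≟ s)) (occursAt? τ j) (allVecs n n))
    (trans (length-filter-sum (counted? τ j s) (allVecs n n))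
      (sum-allVecs n n λ σ → ind (counted? τ j s σ)))

-- The empty pattern occurs vacuously, so totals are the case k = 0 of the occurrence counts and
-- share their enumeration.
countTotal-empty-pattern : ∀ n s → countTotal n s ≡ countOccur n s [] 1
countTotal-empty-pattern n s = sym (cong length (List.filter-all (occursAt? [] 1) (universal (λ _ ()) (permsWithInversions n s))))

-- Adding `c` inversions to every permutation multiplies the generating function by q^c.
countOccur-shift : ∀ n c s (τ : Vec (Fin k) k) j →
  (sumV n n λ v → ind ((isPermutation? v ×-dec (c + inversions v ≟ s)) ×-dec occursAt? τ j v)) ≡
  shift c (λ s → countOccur n s τ j) s
countOccur-shift n zero s τ j = sym (countOccur-sumV n s τ j)
countOccur-shift n (suc c) zero τ j = sumV-zero n n _ λ v →
  ind-no ((isPermutation? v ×-dec (suc c + inversions v ≟ zero)) ×-dec occursAt? τ j v) λ { ((_ , ()) , _) }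
countOccur-shift n (suc c) (suc s) τ j = trans
  (sumV-cong n n λ v → ind-cong
    ((isPermutation? v ×-dec (suc c + inversions v ≟ suc s)) ×-dec occursAt? τ j v)
    ((isPermutation? v ×-dec (c + inversions v ≟ s)) ×-dec occursAt? τ j v)
    (λ ((p , eq) , o) → (p , suc-injective eq) , o)
    (λ ((p , eq) , o) → (p , cong suc eq) , o))
  (countOccur-shift n c s τ j)

-- Every permutation arises exactly once by inserting its entry at `i` into a shorter one. Vectors
-- that repeat the value `x` are not permutations and contribute 0. The position may change from `j`
-- to `j′` because a deletion before the window moves it.
countOccur-insert : ∀ (i : Fin (suc n)) (cost : Fin (suc n) → ℕ) (τ : Vec (Fin k) k) j j′ s →
  (∀ x v → IsPermutation v → inversions (insertEntry i x v) ≡ cost x + inversions v) →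
  (∀ x v → Iff (OccursAt τ j (insertEntry i x v)) (OccursAt τ j′ v)) →
  countOccur (suc n) s τ j ≡ ∑[ x < suc n ] shift (cost x) (λ s → countOccur n s τ j′) s
countOccur-insert {n} i cost τ j j′ s inversions≡ occurs = begin
  countOccur (suc n) s τ j
    ≡⟨ countOccur-sumV (suc n) s τ j ⟩
  sumV (suc n) (suc n) (λ σ → ind (counted? τ j s σ))
    ≡⟨ sumV-insertAt (suc n) n i (λ σ → ind (counted? τ j s σ)) ⟩
  ∑[ x < suc n ] sumV (suc n) n (λ v → ind (counted? τ j s (insertAt v i x)))
    ≡⟨ sum-cong-≗ {suc n} (λ x →
         sumV-punchIn n n x (λ v → ind (counted? τ j s (insertAt v i x))) (avoid x)) ⟩
  ∑[ x < suc n ] sumV n n (λ v → ind (counted? τ j s (insertEntry i x v)))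
    ≡⟨ sum-cong-≗ {suc n} (λ x → sumV-cong n n (counted-insert x)) ⟩
  ∑[ x < suc n ] sumV n n (λ v → ind ((isPermutation? v ×-dec (cost x + inversions v ≟ s)) ×-dec occursAt? τ j′ v))
    ≡⟨ sum-cong-≗ {suc n} (λ x → countOccur-shift n (cost x) s τ j′) ⟩
  ∑[ x < suc n ] shift (cost x) (λ s → countOccur n s τ j′) s ∎
  where
  open ≡-Reasoning
  avoid : ∀ x v a → lookup v a ≡ x → ind (counted? τ j s (insertAt v i x)) ≡ 0
  avoid x v a v[a]≡x = ind-no (counted? τ j s (insertAt v i x)) λ ((perm , _) , _) →
    FinP.punchInᵢ≢i i a (perm _ i
      (trans (insertAt-punchIn v i x a) (trans v[a]≡x (sym (insertAt-lookup v i x)))))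
  counted-insert : ∀ x v → ind (counted? τ j s (insertEntry i x v)) ≡
    ind ((isPermutation? v ×-dec (cost x + inversions v ≟ s)) ×-dec occursAt? τ j′ v)
  counted-insert x v = ind-cong (counted? τ j s (insertEntry i x v))
    ((isPermutation? v ×-dec (cost x + inversions v ≟ s)) ×-dec occursAt? τ j′ v)
    (λ ((perm , eq) , occ) → let perm′ = insertEntry-permutation⁻ i x v perm in
      (perm′ , trans (sym (inversions≡ x v perm′)) eq) , proj₁ (occurs x v) occ)
    (λ ((perm , eq) , occ) →
      (insertEntry-permutation⁺ i x v perm , trans (inversions≡ x v perm) eq) , proj₂ (occurs x v) occ)

box-sum : ∀ i F s → box i F s ≡ ∑[ x < i ] shift (toℕ x) F s
box-sum zero    F s       = refl
box-sum (suc i) F zero    = sym (trans (cong (F 0 +_) (sum-zero {i} _ λ _ → refl)) (+-identityʳ _))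
box-sum (suc i) F (suc s) = cong (F (suc s) +_) (box-sum i F s)

-- When the window is everything, only τ itself has pattern τ, so the generating function is
-- q^inv(τ).
countOccur-self : (τ : Vec (Fin k) k) → IsPermutation τ → ∀ s →
  countOccur k s τ 1 ≡ shift (inversions τ) δ₀ s
countOccur-self {k} τ perm s = begin
  countOccur k s τ 1                          ≡⟨ countOccur-sumV k s τ 1 ⟩
  sumV k k (λ σ → ind (counted? τ 1 s σ))     ≡⟨ sumV-single k k τ _ (λ v v≢τ → ind-no (counted? τ 1 s v) (v≢τ ∘ unique v)) ⟩
  ind (counted? τ 1 s τ)                      ≡⟨ ind-cong (counted? τ 1 s τ) (inversions τ ≟ s) (proj₂ ∘ proj₁) (λ eq → (perm , eq) , self) ⟩
  ind (inversions τ ≟ s)                      ≡⟨ ind-shift (inversions τ) s ⟩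
  shift (inversions τ) δ₀ s                   ∎
  where
  open ≡-Reasoning
  self : OccursAt τ 1 τ
  self a b = subst₂ _<_ (entry-lookup τ a) (entry-lookup τ b) ,
             subst₂ _<_ (sym (entry-lookup τ a)) (sym (entry-lookup τ b))
  unique : ∀ v → Counted τ 1 s v → v ≡ τ
  unique v ((permv , _) , occ) = permutation-by-order v τ permv perm λ a b →
    proj₁ (occ a b) ∘ subst₂ _<_ (sym (entry-lookup v a)) (sym (entry-lookup v b)) ,
    subst₂ _<_ (entry-lookup v a) (entry-lookup v b) ∘ proj₂ (occ a b)
  ind-shift : ∀ t s → ind (t ≟ s) ≡ shift t δ₀ s
  ind-shift zero    zero    = refl
  ind-shift zero    (suc s) = refl
  ind-shift (suc t) zero    = refl
  ind-shift (suc t) (suc s) =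
    trans (ind-cong (suc t ≟ suc s) (t ≟ s) suc-injective (cong suc)) (ind-shift t s)

-- Of the `r` entries outside the window, `p` precede it. The last entry is deleted while `p` is 0
-- and the first one otherwise; both contribute the same factor, so the result is independent of
-- `p`.
countOccur-boxes : (τ : Vec (Fin k) k) → IsPermutation τ → ∀ r p → p ≤ r → ∀ s →
  countOccur (r + k) s τ (suc p) ≡ boxes k r (shift (inversions τ) δ₀) s
countOccur-boxes τ perm zero zero _ s = countOccur-self τ perm s
countOccur-boxes {k} τ perm (suc r) zero _ s = begin
  countOccur (suc (r + k)) s τ 1
    ≡⟨ countOccur-insert (fromℕ (r + k)) (toℕ ∘ opposite) τ 1 1 s inversions-insert-last
         (λ x v → occursAt-insert-last τ 0 x v (m≤n+m k r)) ⟩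
  ∑[ x < suc (r + k) ] shift (toℕ (opposite x)) G s
    -- The costs of a last entry are 0, ..., r + k in reverse order, so reversing the summation
    -- yields the same factor as for a first entry.
    ≡⟨ sum-permute {suc (r + k)} (λ x → shift (toℕ x) G s) reverse ⟨
  ∑[ x < suc (r + k) ] shift (toℕ x) G s
    ≡⟨ box-sum (suc (r + k)) G s ⟨
  box (suc (r + k)) G s
    ≡⟨ box-cong (suc (r + k)) (countOccur-boxes τ perm r zero z≤n) s ⟩
  boxes k (suc r) (shift (inversions τ) δ₀) s ∎
  where
  open ≡-Reasoning
  G : ℕ → ℕ
  G s = countOccur (r + k) s τ 1
countOccur-boxes {k} τ perm (suc r) (suc p) (s≤s p≤r) s = begin
  countOccur (suc (r + k)) s τ (suc (suc p))
    ≡⟨ countOccur-insert zero toℕ τ (suc (suc p)) (suc p) s inversions-insert-first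
         (λ x v → occursAt-insert-first τ p x v (+-monoˡ-≤ k p≤r)) ⟩
  ∑[ x < suc (r + k) ] shift (toℕ x) G s
    ≡⟨ box-sum (suc (r + k)) G s ⟨
  box (suc (r + k)) G s
    ≡⟨ box-cong (suc (r + k)) (countOccur-boxes τ perm r p p≤r) s ⟩
  boxes k (suc r) (shift (inversions τ) δ₀) s ∎
  where
  open ≡-Reasoning
  G : ℕ → ℕ
  G s = countOccur (r + k) s τ (suc p)

countTotal-boxes : ∀ n s → countTotal n s ≡ boxes 0 n δ₀ s
countTotal-boxes n s = trans (countTotal-empty-pattern n s)
  (trans (cong (λ n → countOccur n s [] 1) (sym (+-identityʳ n)))
    (countOccur-boxes [] (λ ()) n 0 z≤n s))

-- The estimate for fixed n and the limit

degree-room : ∀ {k r m M} → M ≤ m → k * k ≤ m → r + k ≤ m → 6 * m ≤ (r + k) * (r + k) → M + m ≤ degree k r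
degree-room {k} {r} {m} {M} M≤m k²≤m n≤m 6m≤n² =
  -- It suffices that 2m ≤ deg. The 6 pays for 4m on the side of 2 deg and for 2m absorbing the
  -- error k² + n.
  ≤-trans (+-monoˡ-≤ m M≤m) (*-cancelˡ-≤ 2 (+-cancelʳ-≤ (m + m) _ _ (begin
    2 * (m + m) + (m + m)               ≡⟨ six m ⟩
    6 * m                               ≤⟨ 6m≤n² ⟩
    (r + k) * (r + k)                   ≤⟨ degree-lower k r ⟩
    2 * degree k r + k * k + (r + k)    ≡⟨ +-assoc (2 * degree k r) (k * k) (r + k) ⟩
    2 * degree k r + (k * k + (r + k))  ≤⟨ +-monoʳ-≤ (2 * degree k r) (+-mono-≤ k²≤m n≤m) ⟩
    2 * degree k r + (m + m)            ∎)))
  where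
  open ≤-Reasoning
  six : ∀ m → 2 * (m + m) + (m + m) ≡ 6 * m
  six = solve-∀

pattern-frequency : ∀ {k} (τ : Vec (Fin k) k) → IsPermutation τ → ∀ {r p m e} → p ≤ r →
  1 ≤ k → 1 ≤ r + k → (2 + e) * (k * k * (r + k)) ≤ m → 6 * m ≤ (r + k) * (r + k) →
  e * ∣ k ! * countOccur (r + k) m τ (suc p) - countTotal (r + k) m ∣ ≤ countTotal (r + k) m
pattern-frequency {k} τ perm {r} {p} {m} {e} p≤r 1≤k 1≤n scale 6m≤n² =
  subst₂ (λ c T → e * ∣ k ! * c - T ∣ ≤ T) (sym occur≡) (sym total≡)
    (dist-bound {e} {k ! * N c} {boxes 0 k N m} lower upper)
  where
  open ≤-Reasoning
  ℓ = r + k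
  K = k * k
  N = boxes k r δ₀
  t = inversions τ
  c = m ∸ t

  1≤K : 1 ≤ K
  1≤K = *-mono-≤ 1≤k 1≤k
  K≤Kn : K ≤ K * ℓ
  K≤Kn = ≤-trans (≤-reflexive (sym (*-identityʳ K))) (*-monoʳ-≤ K 1≤n)
  n≤Kn : ℓ ≤ K * ℓ
  n≤Kn = ≤-trans (≤-reflexive (sym (*-identityˡ ℓ))) (*-monoˡ-≤ ℓ 1≤K)
  Kn≤m : K * ℓ ≤ m
  Kn≤m = ≤-trans (m≤m+n (K * ℓ) _) scale
  -- Of the 2 + e copies of `K * ℓ` in `scale`, one covers the window width `K` and the remaining e
  -- + 1 form the margin.
  low : suc e * (K * ℓ) + K ≤ m
  low = ≤-trans (+-monoʳ-≤ (suc e * (K * ℓ)) K≤Kn)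
    (≤-trans (≤-reflexive (+-comm (suc e * (K * ℓ)) (K * ℓ))) scale)
  K≤m : K ≤ m
  K≤m = ≤-trans K≤Kn Kn≤m
  t≤K : t ≤ K
  t≤K = inversions-≤ τ
  t≤m : t ≤ m
  t≤m = ≤-trans t≤K K≤m

  occur≡ : countOccur ℓ m τ (suc p) ≡ N c
  occur≡ = trans (countOccur-boxes τ perm r p p≤r m)
    (trans (boxes-shift k r t δ₀ m) (shift-∸ t N m t≤m))
  -- `boxes-split` leaves [k]_q! as the inner factor; commuting it outwards exhibits the total as a
  -- weighted sum of coefficients of `N`.
  total≡ : countTotal ℓ m ≡ boxes 0 k N m
  total≡ = trans (countTotal-boxes ℓ m)
    (trans (boxes-split k r δ₀ m) (boxes-comm k r 0 k δ₀ m))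

  near : ∀ {s s′} → m ≤ s + K → s ≤ m → m ≤ s′ + K → s′ ≤ m → e * N s ≤ suc e * N s′
  near = close {e = e} (boxes-slowGrowth k r) (boxes-palindromic k r) (m≤m+n r k)
    (≤-trans 1≤K (≤-trans K≤Kn (m≤m+n (K * ℓ) _))) low
    (degree-room {k} {r} (≤-trans (m≤m+n _ K) low) K≤m (≤-trans n≤Kn Kn≤m) 6m≤n²)
  m≤c+K : m ≤ c + K
  m≤c+K = ≤-trans (≤-reflexive (sym (m∸n+n≡m t≤m))) (+-monoʳ-≤ c t≤K)
  c≤m : c ≤ m
  c≤m = m∸n≤m m t

  -- The single coefficient `N c` is compared with each coefficient of `N` in the window; summing
  -- with total weight k! gives both bounds.
  lower : e * (k ! * N c) ≤ suc e * boxes 0 k N m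
  lower = begin
    e * (k ! * N c)         ≡⟨ *-swap e (k !) (N c) ⟩
    k ! * (e * N c)         ≤⟨ boxes-lower k {β = suc e} {N} m K≤m (λ s s≤m m≤s+K → near m≤c+K c≤m m≤s+K s≤m) ⟩
    suc e * boxes 0 k N m   ∎
  upper : e * boxes 0 k N m ≤ suc e * (k ! * N c)
  upper = begin
    e * boxes 0 k N m       ≤⟨ boxes-upper k {e} {F = N} m (λ s s≤m m≤s+K → near m≤s+K s≤m m≤c+K c≤m) ⟩
    k ! * (suc e * N c)     ≡⟨ *-swap (k !) (suc e) (N c) ⟩
    suc e * (k ! * N c)     ∎

-- With P the quotient of the two counts, the conclusion is |k! P - 1| ≤ 1/(d+1) with the
-- denominators cleared.
theorem1 : (m k : ℕ → ℕ) → ((n : ℕ) → 1 ≤ m n) → ((n : ℕ) → 1 ≤ k n) →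
    ((C : ℕ) → Eventually (λ n → C * n < m n)) →
    ((C : ℕ) → Eventually (λ n → C * (m n * ⌊log₂ n ⌋ ^ 2) < n ^ 2)) →
    ((C : ℕ) → Eventually (λ n → C * (k n ^ 2 * n) < m n)) →
    (τ : (n : ℕ) → Perm (k n)) → (j : ℕ → ℕ) →
    Eventually (λ n → (1 ≤ j n) × (j n + k n ≤ n + 1)) →
    (d : ℕ) → Eventually (λ n →
    suc d * ∣ k n ! * countOccur n (m n) (proj₁ (τ n)) (j n) - countTotal n (m n) ∣
    ≤ countTotal n (m n))
theorem1 m k _ 1≤k _ m≪n²/log² k²n≪m τ j position d
  -- The 6 is the constant of `degree-room`; 3 + d is the factor 2 + e of `pattern-frequency` at e =
  -- d + 1.
  with m≪n²/log² 6 | k²n≪m (3 + d) | position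
... | N₁ , small | N₂ , large | N₃ , inside = 2 + (N₁ + N₂ + N₃) , bound
  where
  square : ∀ x → x ^ 2 ≡ x * x
  square x = cong (x *_) (*-identityʳ x)

  -- Rewrites `n` as the entries outside the window plus `k n`, and the 1-based `j n` as the
  -- successor of the number of entries before the window.
  at : ∀ n r q → n ≡ r + k n → j n ≡ suc q → q ≤ r → 2 ≤ n →
    6 * (m n * ⌊log₂ n ⌋ ^ 2) < n ^ 2 → (3 + d) * (k n ^ 2 * n) < m n →
    suc d * ∣ k n ! * countOccur n (m n) (proj₁ (τ n)) (j n) - countTotal n (m n) ∣ ≤ countTotal n (m n)
  at n r q n≡ j≡ q≤r 2≤n small large =
    subst₂ (λ n′ j′ → suc d * ∣ k n ! * countOccur n′ (m n) (proj₁ (τ n)) j′ - countTotal n′ (m n) ∣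
        ≤ countTotal n′ (m n)) (sym n≡) (sym j≡)
      (pattern-frequency (proj₁ (τ n)) (proj₂ (τ n)) {r} {e = suc d} q≤r (1≤k n)
        (subst (1 ≤_) n≡ (<⇒≤ 2≤n))
        (subst₂ (λ K n′ → (3 + d) * (K * n′) ≤ m n) (square (k n)) n≡ (<⇒≤ large))
        (subst (λ n′ → 6 * m n ≤ n′ * n′) n≡ 6m≤n²))
    where
    open ≤-Reasoning
    -- From n ≥ 2 it follows that ⌊log₂ n⌋ ≥ 1, so inserting its square only enlarges the left side.
    6m≤n² : 6 * m n ≤ n * n
    6m≤n² = begin
      6 * m n                     ≤⟨ *-monoʳ-≤ 6 (≤-trans (≤-reflexive (sym (*-identityʳ (m n))))
                                      (*-monoʳ-≤ (m n) (^-monoˡ-≤ 2 (⌊log₂⌋-mono-≤ 2≤n)))) ⟩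
      6 * (m n * ⌊log₂ n ⌋ ^ 2)   ≤⟨ <⇒≤ small ⟩
      n ^ 2                       ≡⟨ square n ⟩
      n * n                       ∎

  bound : ∀ n → 2 + (N₁ + N₂ + N₃) ≤ n →
    suc d * ∣ k n ! * countOccur n (m n) (proj₁ (τ n)) (j n) - countTotal n (m n) ∣ ≤ countTotal n (m n)
  bound n N≤n with inside n (≤-trans (m≤n+m N₃ (2 + (N₁ + N₂))) N≤n)
  ... | 1≤j , j+k≤n+1 = at n (n ∸ k n) (pred (j n)) (sym (m∸n+n≡m k≤n)) (sym j≡)
    (m+n≤o⇒m≤o∸n (pred (j n)) q+k≤n) (≤-trans (m≤m+n 2 _) N≤n)
    (small n (≤-trans (≤-trans (m≤m+n N₁ N₂) (m≤n+m (N₁ + N₂) 2)) (≤-trans (m≤m+n _ N₃) N≤n)))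
    (large n (≤-trans (m≤n+m N₂ (2 + N₁)) (≤-trans (m≤m+n _ N₃) N≤n)))
    where
    j≡ : suc (pred (j n)) ≡ j n
    j≡ = suc-pred (j n) {{>-nonZero 1≤j}}
    q+k≤n : pred (j n) + k n ≤ n
    q+k≤n = s≤s⁻¹ (subst₂ _≤_ (cong (_+ k n) (sym j≡)) (+-comm n 1) j+k≤n+1)
    k≤n : k n ≤ n
    k≤n = ≤-trans (m≤n+m (k n) (pred (j n))) q+k≤n
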